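{- Let $G$ be a countably infinite discrete group and let $X$ be an aperiodic Borel $G$-space. Then there is a $G$-equivariant Borel map from $X$ to the aperiodic part of the shift action of $G$ on $2^G$, i.e. a $G$-equivariant Borel map $f:X\to 2^G$ such that for every $x\in X$ the $G$-orbit of $f(x)$ in $2^G$ is infinite.
   Context: A Borel $G$-space is a standard Borel space $X$ equipped with a Borel action of $G$; it is aperiodic if every orbit is infinite. $2^G=\{0,1\}^G$ has the product topology and the shift action $(g\cdot y)(h)=y(g^{ -1}h)$ for $g,h\in G$, $y\in 2^G$. The aperiodic part of $2^G$ is the invariant set of all $y\in 2^G$ whose orbit is infinite. -}

module Defs where

open import Level using (Level; 0ℓ; _⊔_; Lift; lift; lower) renaming (suc to lsuc)
open import Algebra.Bundles using (Group)
import Algebra.Properties.Group as GroupProperties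
open import Data.Bool.Base using (Bool)
open import Data.List.Base using (List; []; _++_)
open import Data.List.Relation.Unary.All using (All; []; universal)
open import Data.List.Relation.Unary.All.Properties using (++⁻ˡ; ++⁻ʳ)
import Data.List.Membership.Setoid as Membership
open import Data.Maybe.Base using (Maybe; just)
open import Data.Nat.Base as ℕ using (ℕ)
open import Data.Product using (∃; ∃₂; ∃-syntax; Σ-syntax; _×_; _,_)
open import Data.Product.Relation.Binary.Pointwise.NonDependent using (×-setoid)
open import Data.Rational.Base as ℚ using (ℚ; 0ℚ; 1ℚ)
import Data.Rational.Properties as ℚ
open import Function.Base using (_∘_)
open import Function.Bundles using (Func; _⟨$⟩_; _⇔_)
open import Function.Metric.Structures using (IsGeneralMetric)
import Function.Relation.Binary.Setoid.Equality as FuncEquality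
open import Relation.Binary.Bundles using (Setoid)
open import Relation.Binary.Definitions using (_Respects_)
open import Relation.Binary.PropositionalEquality as ≡ using (_≡_)
open import Relation.Nullary.Negation using (¬_)
open import Relation.Unary using (Pred; ∅; U; ∁; _∩_; ⋃; _≐_; _⊆_; _⟨×⟩_)

------------------------------------------------------------------------
-- Real numbers

-- A real x is the open upper half of a Dedekind cut, {q ∈ ℚ | x < q}.

record ℝ : Set₁ where
  field
    upper     : Pred ℚ 0ℓ
    inhabited : ∃[ q ] upper q
    proper    : ∃[ q ] ¬ upper q
    closed    : ∀ {p q} → p ℚ.< q → upper p → upper q
    rounded   : ∀ {q} → upper q → ∃[ p ] (p ℚ.< q × upper p)

infix 4 _<ᵘ_ _≈ᴿ_ _≤ᴿ_

_<ᵘ_ : ℝ → ℚ → Set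
x <ᵘ q = ℝ.upper x q

_≈ᴿ_ _≤ᴿ_ : ℝ → ℝ → Set
x ≈ᴿ y = ℝ.upper x ≐ ℝ.upper y
x ≤ᴿ y = ℝ.upper y ⊆ ℝ.upper x

0ᴿ : ℝ
0ᴿ = record
  { upper     = 0ℚ ℚ.<_
  ; inhabited = 1ℚ , ℚ.positive⁻¹ 1ℚ
  ; proper    = 0ℚ , ℚ.<-irrefl ≡.refl
  ; closed    = λ p<q 0<p → ℚ.<-trans 0<p p<q
  ; rounded   = λ 0<q → let (p , 0<p , p<q) = ℚ.<-dense 0<q in p , p<q , 0<p
  }

infixl 6 _+ᴿ_

_+ᴿ_ : ℝ → ℝ → ℝ
x +ᴿ y = record
  { upper     = λ r → ∃₂ λ p q → x <ᵘ p × y <ᵘ q × p ℚ.+ q ℚ.< r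
  ; inhabited =
      let (p , x<p) = X.inhabited
          (q , y<q) = Y.inhabited
      in (p ℚ.+ q) ℚ.+ 1ℚ , p , q , x<p , y<q ,
         ≡.subst (ℚ._< (p ℚ.+ q) ℚ.+ 1ℚ) (ℚ.+-identityʳ (p ℚ.+ q))
           (ℚ.+-monoʳ-< (p ℚ.+ q) (ℚ.positive⁻¹ 1ℚ))
  ; proper    =
      let (a , x≮a) = X.proper
          (b , y≮b) = Y.proper
      in a ℚ.+ b , λ (p , q , x<p , y<q , p+q<a+b) →
         ℚ.<-irrefl ≡.refl (ℚ.<-≤-trans p+q<a+b
           (ℚ.+-mono-≤ (ℚ.≮⇒≥ λ p<a → x≮a (X.closed p<a x<p))
                       (ℚ.≮⇒≥ λ q<b → y≮b (Y.closed q<b y<q))))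
  ; closed    = λ r<s (p , q , x<p , y<q , p+q<r) →
      p , q , x<p , y<q , ℚ.<-trans p+q<r r<s
  ; rounded   = λ (p , q , x<p , y<q , p+q<r) →
      let (s , p+q<s , s<r) = ℚ.<-dense p+q<r
      in s , s<r , p , q , x<p , y<q , p+q<s
  }
  where module X = ℝ x
        module Y = ℝ y

------------------------------------------------------------------------
-- Topological spaces

-- Sets of points are setoids throughout.  Subsets are predicates; open and
-- measurable ones are required to respect the equality of points.

record Topology (S : Setoid 0ℓ 0ℓ) : Set₁ where
  open Setoid S
  field
    Open    : Pred (Pred Carrier 0ℓ) 0ℓ
    resp-≈  : ∀ {A} → Open A → A Respects _≈_
    resp-≐  : ∀ {A B} → A ≐ B → Open A → Open B
    whole   : Open U
    inter   : ∀ {A B} → Open A → Open B → Open (A ∩ B)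
    union   : ∀ {I : Set} (A : I → Pred Carrier 0ℓ) →
              (∀ i → Open (A i)) → Open (⋃ I A)

module _ (S : Setoid 0ℓ 0ℓ) where
  open Setoid S

  IsMetric : (Carrier → Carrier → ℝ) → Set₁
  IsMetric = IsGeneralMetric _≈_ _≈ᴿ_ _≤ᴿ_ 0ᴿ _+ᴿ_

  MetricOpen : (Carrier → Carrier → ℝ) → Pred (Pred Carrier 0ℓ) 0ℓ
  MetricOpen d A =
    ∀ x → A x → ∃[ ε ] (0ℚ ℚ.< ε × (∀ y → d x y <ᵘ ε → A y))

  IsCauchy : (Carrier → Carrier → ℝ) → (ℕ → Carrier) → Set
  IsCauchy d s = ∀ ε → 0ℚ ℚ.< ε →
    ∃[ N ] (∀ m n → N ℕ.≤ m → N ℕ.≤ n → d (s m) (s n) <ᵘ ε)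

  ConvergesTo : (Carrier → Carrier → ℝ) → (ℕ → Carrier) → Carrier → Set
  ConvergesTo d s x = ∀ ε → 0ℚ ℚ.< ε →
    ∃[ N ] (∀ n → N ℕ.≤ n → d (s n) x <ᵘ ε)

  IsComplete : (Carrier → Carrier → ℝ) → Set
  IsComplete d = ∀ s → IsCauchy d s → ∃[ x ] ConvergesTo d s x

module _ {S : Setoid 0ℓ 0ℓ} where
  open Setoid S

  IsCompletelyMetrizable : Topology S → Set₁
  IsCompletelyMetrizable τ = Σ[ d ∈ (Carrier → Carrier → ℝ) ]
    IsMetric S d × IsComplete S d × (∀ A → Topology.Open τ A ⇔ MetricOpen S d A)

  -- The countable dense set is the set of defined values of a partial
  -- enumeration, so that the empty space is separable.

  IsSeparable : Topology S → Set₁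
  IsSeparable τ = Σ[ e ∈ (ℕ → Maybe Carrier) ]
    (∀ A → Topology.Open τ A → ∃ A → ∃₂ λ n x → e n ≡ just x × A x)

  IsPolish : Topology S → Set₁
  IsPolish τ = IsSeparable τ × IsCompletelyMetrizable τ

------------------------------------------------------------------------
-- Measurable spaces

data σ⟨_⟩ {X : Set} {g : Level} (𝒢 : Pred (Pred X 0ℓ) g) :
          Pred (Pred X 0ℓ) (lsuc 0ℓ ⊔ g) where
  generator  : ∀ {A} → 𝒢 A → σ⟨ 𝒢 ⟩ A
  resp-≐     : ∀ {A B} → A ≐ B → σ⟨ 𝒢 ⟩ A → σ⟨ 𝒢 ⟩ B
  empty      : σ⟨ 𝒢 ⟩ ∅
  complement : ∀ {A} → σ⟨ 𝒢 ⟩ A → σ⟨ 𝒢 ⟩ (∁ A)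
  union      : (A : ℕ → Pred X 0ℓ) → (∀ n → σ⟨ 𝒢 ⟩ (A n)) → σ⟨ 𝒢 ⟩ (⋃ ℕ A)

record MeasurableSpace : Set₂ where
  field
    points       : Setoid 0ℓ 0ℓ
  open Setoid points public
  field
    Measurable   : Pred (Pred Carrier 0ℓ) (lsuc 0ℓ)
    measurable-≈ : ∀ {A} → Measurable A → A Respects _≈_
    measurable-≐ : ∀ {A B} → A ≐ B → Measurable A → Measurable B
    ∅-measurable : Measurable ∅
    ∁-measurable : ∀ {A} → Measurable A → Measurable (∁ A)
    ⋃-measurable : (A : ℕ → Pred Carrier 0ℓ) →
                   (∀ n → Measurable (A n)) → Measurable (⋃ ℕ A)

module _ (S : Setoid 0ℓ 0ℓ) where
  open Setoid S

  generated-resp-≈ : ∀ {g} (𝒢 : Pred (Pred Carrier 0ℓ) g) →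
                     (∀ {A} → 𝒢 A → A Respects _≈_) →
                     ∀ {A} → σ⟨ 𝒢 ⟩ A → A Respects _≈_
  generated-resp-≈ 𝒢 r (generator a)             x≈y Ax       = r a x≈y Ax
  generated-resp-≈ 𝒢 r (resp-≐ (A⊆B , B⊆A) a)    x≈y Bx       = A⊆B (generated-resp-≈ 𝒢 r a x≈y (B⊆A Bx))
  generated-resp-≈ 𝒢 r (complement a)            x≈y ¬Ax Ay   = ¬Ax (generated-resp-≈ 𝒢 r a (sym x≈y) Ay)
  generated-resp-≈ 𝒢 r (union A as)              x≈y (n , An) = n , generated-resp-≈ 𝒢 r (as n) x≈y An

  generatedSpace : (𝒢 : Pred (Pred Carrier 0ℓ) (lsuc 0ℓ)) →
                   (∀ {A} → 𝒢 A → A Respects _≈_) → MeasurableSpace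
  generatedSpace 𝒢 r = record
    { points = S ; Measurable = σ⟨ 𝒢 ⟩ ; measurable-≈ = generated-resp-≈ 𝒢 r
    ; measurable-≐ = resp-≐ ; ∅-measurable = empty ; ∁-measurable = complement
    ; ⋃-measurable = union }

  discreteSpace : MeasurableSpace
  discreteSpace = record
    { points       = S
    ; Measurable   = λ A → Lift (lsuc 0ℓ) (A Respects _≈_)
    ; measurable-≈ = lower
    ; measurable-≐ = λ (A⊆B , B⊆A) (lift a) → lift λ x≈y Bx → A⊆B (a x≈y (B⊆A Bx))
    ; ∅-measurable = lift λ _ ()
    ; ∁-measurable = λ (lift a) → lift λ x≈y ¬Ax Ay → ¬Ax (a (sym x≈y) Ay)
    ; ⋃-measurable = λ A as → lift λ x≈y (n , An) → n , lower (as n) x≈y An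
    }

borelSpace : {S : Setoid 0ℓ 0ℓ} → Topology S → MeasurableSpace
borelSpace {S} τ = record
  { points = S ; Measurable = σ⟨ Topology.Open τ ⟩
  ; measurable-≈ = generated-resp-≈ S (Topology.Open τ) (Topology.resp-≈ τ)
  ; measurable-≐ = resp-≐ ; ∅-measurable = empty ; ∁-measurable = complement
  ; ⋃-measurable = union }

productSpace : MeasurableSpace → MeasurableSpace → MeasurableSpace
productSpace M N = generatedSpace (×-setoid M.points N.points) Rectangle
  λ (A , B , a , b , C⊆ , ⊆C) (x≈ , y≈) Cxy →
    let (Ax , By) = C⊆ Cxy in ⊆C (M.measurable-≈ a x≈ Ax , N.measurable-≈ b y≈ By)
  where
  module M = MeasurableSpace M
  module N = MeasurableSpace N
  Rectangle : Pred (Pred (M.Carrier × N.Carrier) 0ℓ) (lsuc 0ℓ)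
  Rectangle C = ∃₂ λ A B → M.Measurable A × N.Measurable B × C ≐ (A ⟨×⟩ B)

IsMeasurableMap : (M N : MeasurableSpace) →
  Func (MeasurableSpace.points M) (MeasurableSpace.points N) → Set₁
IsMeasurableMap M N f = ∀ B → MeasurableSpace.Measurable N B →
  MeasurableSpace.Measurable M (λ x → B (f ⟨$⟩ x))

IsStandardBorel : MeasurableSpace → Set₁
IsStandardBorel M = Σ[ τ ∈ Topology points ]
  IsPolish τ × (∀ A → Measurable A ⇔ σ⟨ Topology.Open τ ⟩ A)
  where open MeasurableSpace M

------------------------------------------------------------------------
-- Group actions

IsFinite : (S : Setoid 0ℓ 0ℓ) → Pred (Setoid.Carrier S) 0ℓ → Set
IsFinite S A = Σ[ xs ∈ List (Setoid.Carrier S) ] (∀ x → A x → x ∈ xs)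
  where open Membership S

IsInfinite : (S : Setoid 0ℓ 0ℓ) → Pred (Setoid.Carrier S) 0ℓ → Set
IsInfinite S A = ¬ IsFinite S A

record Action (G : Group 0ℓ 0ℓ) (S : Setoid 0ℓ 0ℓ) : Set where
  private module G = Group G
  open Setoid S
  field
    act : Func (×-setoid G.setoid S) S
  infixr 7 _·_
  _·_ : G.Carrier → Carrier → Carrier
  g · x = act ⟨$⟩ (g , x)
  field
    identity : ∀ x → G.ε · x ≈ x
    compose  : ∀ g h x → (g G.∙ h) · x ≈ g · (h · x)

  Orbit : Carrier → Pred Carrier 0ℓ
  Orbit x y = ∃[ g ] g · x ≈ y

  AperiodicPart : Pred Carrier 0ℓ
  AperiodicPart x = IsInfinite S (Orbit x)

  IsAperiodic : Set
  IsAperiodic = ∀ x → AperiodicPart x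

IsEquivariant : {G : Group 0ℓ 0ℓ} {S T : Setoid 0ℓ 0ℓ} →
                Action G S → Action G T → Func S T → Set
IsEquivariant {T = T} α β f = ∀ g x → f ⟨$⟩ (g α.· x) ≈ g β.· (f ⟨$⟩ x)
  where
  open Setoid T
  module α = Action α
  module β = Action β

-- G is discrete, so G × X carries the product of the σ-algebra of all subsets
-- of G with the σ-algebra of X.

record BorelSpaceOver (G : Group 0ℓ 0ℓ) : Set₂ where
  field
    space           : MeasurableSpace
    isStandardBorel : IsStandardBorel space
    action          : Action G (MeasurableSpace.points space)
    isBorelAction   : IsMeasurableMap
                        (productSpace (discreteSpace (Group.setoid G)) space)
                        space (Action.act action)
  open MeasurableSpace space public using (points)
  open Action action public using (IsAperiodic)

------------------------------------------------------------------------
-- The shift on 2^G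

module _ (G : Group 0ℓ 0ℓ) where
  private module G = Group G
  open GroupProperties G using (⁻¹-anti-homo-∙; ε⁻¹≈ε)

  -- Functions G → {0,1} up to pointwise equality.

  2^ : Setoid 0ℓ 0ℓ
  2^ = FuncEquality.setoid G.setoid (≡.setoid Bool)

  open Setoid 2^ using () renaming (Carrier to 2^G)

  productTopology : Topology 2^
  productTopology = record
    { Open   = λ A → ∀ y → A y → ∃[ F ] Cylinder y F ⊆ A
    ; resp-≈ = λ o {y} {z} y≈z Ay → let (F , c) = o y Ay in
               c (universal (λ h → ≡.sym (y≈z h)) F)
    ; resp-≐ = λ (A⊆B , B⊆A) o y By → let (F , c) = o y (B⊆A By) in F , A⊆B ∘ c
    ; whole  = λ _ _ → [] , _
    ; inter  = λ o p y (Ay , By) →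
        let (E , c) = o y Ay
            (F , d) = p y By
        in E ++ F , λ w → c (++⁻ˡ E w) , d (++⁻ʳ E w)
    ; union  = λ _ os y (i , Ay) → let (F , c) = os i y Ay in F , λ w → i , c w
    }
    where
    Cylinder : 2^G → List G.Carrier → Pred 2^G 0ℓ
    Cylinder y F z = All (λ h → z ⟨$⟩ h ≡ y ⟨$⟩ h) F

  shift : Action G 2^
  shift = record
    { act = record
        { to   = λ (g , y) → translate g y
        ; cong = λ { {g , y} {h , z} (g≈h , y≈z) k →
            ≡.trans (y≈z (g G.⁻¹ G.∙ k)) (Func.cong z (G.∙-congʳ (G.⁻¹-cong g≈h))) }
        }
    ; identity = λ y h → Func.cong y (G.trans (G.∙-congʳ ε⁻¹≈ε) (G.identityˡ h))
    ; compose  = λ g k y h → Func.cong y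
        (G.trans (G.∙-congʳ (⁻¹-anti-homo-∙ g k)) (G.assoc (k G.⁻¹) (g G.⁻¹) h))
    }
    where
    translate : G.Carrier → 2^G → 2^G
    translate g y = record
      { to   = λ h → y ⟨$⟩ (g G.⁻¹ G.∙ h)
      ; cong = λ h≈k → Func.cong y (G.∙-congˡ h≈k)
      }

{-# OPTIONS --safe #-}

-- Let f_A : X → 2^G, f_A(x)(g) = [g⁻¹x ∈ A].  It suffices to find countably many
-- Borel sets such that on every orbit some f_A takes infinitely many values: take,
-- orbit by orbit, the first one that works.
-- Let C₀, C₁, … be Borel sets separating points, and suppose that every f_{Cₙ} has
-- finite image on the orbit O.  Put P₀ = X, and let Pₙ₊₁ ∩ O consist of the points of
-- Pₙ ∩ O whose value under f_{Cₙ} is lexicographically greatest.  The Pₙ ∩ O are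
-- decreasing nonempty blocks of the action.  If they stabilise, they do so at a
-- singleton {p}, and then f_{Pₙ} is injective on O.  Otherwise let n₀ < n₁ < … be the
-- stages where Pₙ ∩ O shrinks, and let A be the set of points lost at the stages of
-- even rank.  If f_A had finite image on O, pick points zᵢ ∈ O lost at stage nᵢ; by
-- pigeonhole some g with g zᵢ = zⱼ, i < j, leaves A ∩ O invariant.  By the block property
-- g maps zᵢ₊₁ to a point lost at stage nᵢ, although nᵢ and nᵢ₊₁ have ranks of
-- different parity.

module Submission where

open import Defs
open import Level using (0ℓ)
open import Algebra.Bundles using (Group)
import Algebra.Properties.Group as GroupProperties
open import Axiom.DoubleNegationElimination using (em⇒dne)
open import Axiom.ExcludedMiddle using (ExcludedMiddle)
open import Data.Bool.Base using (Bool; true; false)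
open import Data.Empty using (⊥; ⊥-elim)
open import Data.Fin.Base using (Fin; toℕ; fromℕ<; funToFin; finToFun)
open import Data.Fin.Properties using (pigeonhole; finToFun-funToFin; toℕ-fromℕ<)
import Data.Integer.Base as ℤ
open import Data.List.Base using (applyUpTo; []; _∷_)
import Data.List.Membership.Setoid as Membership
open import Data.List.Membership.Setoid.Properties using (∈-applyUpTo⁺; ∈-resp-≈)
open import Data.List.Relation.Unary.All using (All; []; _∷_)
open import Data.List.Relation.Unary.Any using (here; there)
open import Data.Maybe.Base using (just; nothing)
open import Data.Maybe.Properties using (just-injective)
open import Data.Nat.Base as ℕ using (ℕ; zero; suc; _+_; _<_; _≤_)
import Data.Nat.Properties as ℕ
open import Data.Product using (∃; ∃₂; ∃-syntax; Σ-syntax; _×_; _,_; proj₁; proj₂; map₂)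
open import Data.Rational.Base as ℚ using (ℚ; 0ℚ; ½)
import Data.Rational.Properties as ℚ
open import Data.Sum.Base using (_⊎_; inj₁; inj₂; [_,_]′)
open import Data.Unit.Base using (⊤; tt)
open import Function.Base using (_∘_; id; case_of_)
open import Function.Bundles using (Func; Equivalence; Inverse; _⟨$⟩_; _⇔_; mk⇔)
open import Function.Metric.Structures using (IsGeneralMetric)
open import Function.Properties.Equivalence using (⇔-isEquivalence)
open import Relation.Binary.Bundles using (Setoid)
open import Relation.Binary.Definitions using (tri<; tri≈; tri>; _Respects_)
open import Relation.Binary.PropositionalEquality as ≡ using (_≡_; setoid)
open import Relation.Binary.Structures using (IsEquivalence)
open import Relation.Nullary using (¬_; Dec; yes; no)
open import Relation.Nullary.Decidable using (does; does-⇔; dec-true; dec-false)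
open import Relation.Unary using (Pred; _⊆_)

open Equivalence using (to; from)

private module ⇔ {ℓ} = IsEquivalence (⇔-isEquivalence {ℓ})

-- Enumerations of pairs and of positive rationals

-- The path through ℕ × ℕ along successive antidiagonals.
step : ℕ × ℕ → ℕ × ℕ
step (zero  , b) = suc b , zero
step (suc a , b) = a , suc b

unpair : ℕ → ℕ × ℕ
unpair zero    = zero , zero
unpair (suc n) = step (unpair n)

-- The path is traced backwards: the predecessor of `(a , suc b)` lies on the same antidiagonal,
-- that of `(suc a , 0)` on the previous one, so the induction is on `s` and then on `b`.
unpair-surjective : ∀ a b → ∃[ n ] unpair n ≡ (a , b)
unpair-surjective a b = along (a + b) a b ≡.refl
  where
  along : ∀ s a b → a + b ≡ s → ∃[ n ] unpair n ≡ (a , b)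
  along zero    zero    zero    eq = zero , ≡.refl
  along (suc s) (suc a) zero    eq =
    let n , p = along s zero a (ℕ.suc-injective (≡.trans (≡.sym (ℕ.+-identityʳ _)) eq))
    in suc n , ≡.cong step p
  along s       a       (suc b) eq =
    let n , p = along s (suc a) b (≡.trans (≡.sym (ℕ.+-suc a b)) eq)
    in suc n , ≡.cong step p

abstract
  halve : ∀ {q} → 0ℚ ℚ.< q → ∃[ h ] 0ℚ ℚ.< h × h ℚ.+ h ≡ q
  halve {q} 0<q = ½ ℚ.* q
    , ≡.subst (ℚ._< ½ ℚ.* q) (ℚ.*-zeroʳ ½) (ℚ.*-monoʳ-<-pos ½ 0<q)
    , ≡.trans (≡.sym (ℚ.*-distribʳ-+ q ½ ½)) (ℚ.*-identityˡ q)

p+[q-p]≡q : ∀ p q → p ℚ.+ (q ℚ.- p) ≡ q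
p+[q-p]≡q p q = ≡.trans (ℚ.+-comm p (q ℚ.- p)) (//-rightDividesˡ p q)
  where open GroupProperties ℚ.+-0-group using (//-rightDividesˡ)

p<q⇒0<q-p : ∀ {p q} → p ℚ.< q → 0ℚ ℚ.< q ℚ.- p
p<q⇒0<q-p {p} {q} p<q =
  ≡.subst (ℚ._< q ℚ.- p) (ℚ.+-inverseʳ p) (ℚ.+-monoˡ-< (ℚ.- p) p<q)

radius : ℕ × ℕ → ℚ
radius (a , b) = ℤ.+ a ℚ./ suc b

abstract
  ℕ×ℚ-enumeration : ℕ → ℕ × ℚ
  ℕ×ℚ-enumeration i = map₂ (radius ∘ unpair) (unpair i)

  -- In lowest terms `q` is `(1 + a) / (1 + b)`, the `radius` of `(suc a , b)`; a second pairing
  -- adjoins `n`.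
  ℕ×ℚ-enumerated : ∀ n {q} → 0ℚ ℚ.< q → ∃[ i ] ℕ×ℚ-enumeration i ≡ (n , q)
  ℕ×ℚ-enumerated n {q} 0<q with q | ℚ.positive 0<q
  ... | p@(ℚ.mkℚ ℤ.+[1+ a ] b _) | _ =
    let j , eqʲ = unpair-surjective (suc a) b
        i , eqⁱ = unpair-surjective n j
    in i , ≡.trans (≡.cong (map₂ (radius ∘ unpair)) eqⁱ)
                   (≡.cong (n ,_) (≡.trans (≡.cong radius eqʲ) (ℚ.↥p/↧p≡p p)))

-- Countably many balls separating the points of a Polish space

SeparatesPoints : (M : MeasurableSpace) → (ℕ → Pred (MeasurableSpace.Carrier M) 0ℓ) → Set
SeparatesPoints M C = ∀ {x y} → (∀ n → C n x ⇔ C n y) → x ≈ y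
  where open MeasurableSpace M

module _ (M : MeasurableSpace) (standard : IsStandardBorel M) where
  open MeasurableSpace M using (Carrier; points; Measurable; measurable-≐; ∅-measurable)
  private
    τ = proj₁ standard
    dense = proj₂ (proj₁ (proj₁ (proj₂ standard)))
    centre = proj₁ (proj₁ (proj₁ (proj₂ standard)))
    d = proj₁ (proj₂ (proj₁ (proj₂ standard)))
    isMetric = proj₁ (proj₂ (proj₂ (proj₁ (proj₂ standard))))
    open⇔ = proj₂ (proj₂ (proj₂ (proj₂ (proj₁ (proj₂ standard)))))
    borel⇔ = proj₂ (proj₂ standard)
    module d = IsGeneralMetric isMetric

  Ball : Carrier → ℚ → Pred Carrier 0ℓ
  Ball c r y = d c y <ᵘ r

  -- The upper cut of a sum asks for a strict inequality, so roundedness first shrinks `p` to some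
  -- `p′`.
  triangle-< : ∀ {x p q} y {z r} → d x y <ᵘ p → d y z <ᵘ q → p ℚ.+ q ≡ r → d x z <ᵘ r
  triangle-< {x} {p} {q} y {z} {r} xy yz eq =
    let p′ , p′<p , xy′ = ℝ.rounded (d x y) xy
    in d.triangle x y z (p′ , q , xy′ , yz , ≡.subst (p′ ℚ.+ q ℚ.<_) eq (ℚ.+-monoˡ-< q p′<p))

  Ball-open : ∀ c r → Topology.Open τ (Ball c r)
  Ball-open c r = from (open⇔ (Ball c r)) λ x c<r →
    let p , p<r , c<p = ℝ.rounded (d c x) c<r
    in r ℚ.- p , p<q⇒0<q-p p<r , λ y x<ε → triangle-< x c<p x<ε (p+[q-p]≡q p r)

  rationalBall : ℕ × ℚ → Pred Carrier 0ℓ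
  rationalBall (n , r) y = ∃[ c ] centre n ≡ just c × Ball c r y

  rationalBall-measurable : ∀ i → Measurable (rationalBall i)
  rationalBall-measurable (n , r) with centre n
  ... | just c  = measurable-≐ ((λ b → c , ≡.refl , b) , λ { (_ , ≡.refl , b) → b })
                    (from (borel⇔ _) (generator (Ball-open c r)))
  ... | nothing = measurable-≐ ((λ ()) , λ ()) ∅-measurable

  -- A dense point `c` within `q / 2` of `x` has a listed ball of radius `q / 2` containing `x`,
  -- hence also `y`; so `d x y` is below every positive `q`.
  rationalBall-separates : SeparatesPoints M (rationalBall ∘ ℕ×ℚ-enumeration)
  rationalBall-separates {x} {y} same = d.0⇒≈ (d.nonNegative , small)
    where
    small : ∀ {q} → 0ℚ ℚ.< q → d x y <ᵘ q
    small {q} 0<q with halve 0<q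
    ... | h , 0<h , h+h≡q
      with dense (Ball x h) (Ball-open x h) (x , proj₂ (d.≈⇒0 (Setoid.refl points)) 0<h)
    ... | n , c , n≡c , x<h with ℕ×ℚ-enumerated n 0<h
    ... | i , i≡ with ≡.subst (λ p → rationalBall p x → rationalBall p y) i≡ (to (same i))
                        (c , n≡c , proj₁ (d.sym x c) x<h)
    ... | c′ , n≡c′ , c′<h = triangle-< c x<h
      (≡.subst (λ z → Ball z h y) (just-injective (≡.trans (≡.sym n≡c′) n≡c)) c′<h) h+h≡q

-- Classical logic, least numbers and greatest elements

module Classical (em : ∀ {ℓ} → ExcludedMiddle ℓ) where

  dne : ∀ {p} {P : Set p} → ¬ ¬ P → P
  dne = em⇒dne em

  ¬∀⇒∃¬ : ∀ {a p} {A : Set a} {P : A → Set p} → ¬ (∀ x → P x) → ∃[ x ] ¬ P x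
  ¬∀⇒∃¬ ¬∀ = dne λ ¬∃ → ¬∀ λ x → dne λ ¬Px → ¬∃ (x , ¬Px)

  ¬→⇒×¬ : ∀ {p q} {P : Set p} {Q : Set q} → ¬ (P → Q) → P × ¬ Q
  ¬→⇒×¬ ¬pq = dne (λ ¬p → ¬pq λ p → ⊥-elim (¬p (p , λ q → ¬pq λ _ → q)))

  least : (P : ℕ → Set) → ∀ n → P n → ∃[ m ] P m × (∀ {k} → k < m → ¬ P k)
  least P n Pn with em {P = P 0}
  ... | yes P0 = 0 , P0 , λ ()
  least P zero    Pn | no ¬P0 = ⊥-elim (¬P0 Pn)
  least P (suc n) Pn | no ¬P0 with least (P ∘ suc) n Pn
  ... | m , Pm , min = suc m , Pm , λ { {zero} _ → ¬P0 ; {suc k} (ℕ.s≤s k<m) → min k<m }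

  -- Induction on the number of classes of the total preorder, removing the class of `v N`. If `Q`
  -- meets that class in `q`, either `q` is greatest or the search continues among the elements not
  -- below `q`, which avoid the class.
  greatest : {A : Set} (_≼_ : A → A → Set) →
             (∀ {x y z} → x ≼ y → y ≼ z → x ≼ z) → (∀ x y → x ≼ y ⊎ y ≼ x) →
             (v : ℕ → A) (N : ℕ) (Q : Pred A 0ℓ) →
             (∀ {y} → Q y → ∃[ n ] n < N × y ≼ v n × v n ≼ y) →
             ∃ Q → ∃[ m ] Q m × (∀ {y} → Q y → y ≼ m)
  greatest _≼_ tr tot v zero Q cover (y , Qy) with cover Qy
  ... | _ , () , _
  greatest _≼_ tr tot v (suc N) Q cover nonempty
    with em {P = ∃[ q ] Q q × q ≼ v N × v N ≼ q}
  ... | no ¬q = greatest _≼_ tr tot v N Q below nonempty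
    where
    below : ∀ {y} → Q y → ∃[ n ] n < N × y ≼ v n × v n ≼ y
    below {y} Qy with cover Qy
    ... | n , ℕ.s≤s n≤N , eq with ℕ.m≤n⇒m<n∨m≡n n≤N
    ... | inj₁ n<N    = n , n<N , eq
    ... | inj₂ ≡.refl = ⊥-elim (¬q (y , Qy , eq))
  ... | yes (q , Qq , q≼v , v≼q) with em {P = ∃[ y ] Q y × ¬ y ≼ q}
  ... | no ¬y = q , Qq , λ Qy → dne λ y⋠q → ¬y (_ , Qy , y⋠q)
  ... | yes above
    with greatest _≼_ tr tot v N (λ y → Q y × ¬ y ≼ q) below above
    where
    below : ∀ {y} → Q y × ¬ y ≼ q → ∃[ n ] n < N × y ≼ v n × v n ≼ y
    below (Qy , y⋠q) with cover Qy
    ... | n , ℕ.s≤s n≤N , y≼v , v≼y with ℕ.m≤n⇒m<n∨m≡n n≤N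
    ... | inj₁ n<N    = n , n<N , y≼v , v≼y
    ... | inj₂ ≡.refl = ⊥-elim (y⋠q (tr y≼v v≼q))
  ... | m , (Qm , m⋠q) , max = m , Qm , λ {y} Qy → bound Qy em
    where
    bound : ∀ {y} → Q y → Dec (y ≼ q) → y ≼ m
    bound {y} Qy (no y⋠q)  = max (Qy , y⋠q)
    bound {y} Qy (yes y≼q) = tr y≼q ([ id , ⊥-elim ∘ m⋠q ]′ (tot q m))

-- Measurability of sets defined by logical formulas

module MeasurableSets (em : ∀ {ℓ} → ExcludedMiddle ℓ) (M : MeasurableSpace) where
  open MeasurableSpace M
  open Classical em

  private variable A B : Pred Carrier 0ℓ

  constant : (P : Set) → Measurable (λ _ → P)
  constant P with em {P = P}
  ... | yes p = measurable-≐ ((λ _ → p) , λ _ ()) (∁-measurable ∅-measurable)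
  ... | no ¬p = measurable-≐ ((λ ()) , ¬p) ∅-measurable

  infixr 4 _⇒_
  infixr 5 _∪ᵐ_
  infixr 6 _∩ᵐ_

  any : {A : ℕ → Pred Carrier 0ℓ} → (∀ n → Measurable (A n)) →
        Measurable (λ x → ∃[ n ] A n x)
  any = ⋃-measurable _

  all : {A : ℕ → Pred Carrier 0ℓ} → (∀ n → Measurable (A n)) →
        Measurable (λ x → ∀ n → A n x)
  all as = measurable-≐
    ((λ ¬any n → dne λ ¬An → ¬any (n , ¬An)) , λ ∀A (n , ¬An) → ¬An (∀A n))
    (∁-measurable (any (∁-measurable ∘ as)))

  _∪ᵐ_ : Measurable A → Measurable B → Measurable (λ x → A x ⊎ B x)
  _∪ᵐ_ {A} {B} a b = measurable-≐
    ((λ { (zero , Ax) → inj₁ Ax ; (suc _ , Bx) → inj₂ Bx }) ,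
      λ { (inj₁ Ax) → 0 , Ax ; (inj₂ Bx) → 1 , Bx })
    (any {λ { zero → A ; (suc _) → B }} λ { zero → a ; (suc _) → b })

  _∩ᵐ_ : Measurable A → Measurable B → Measurable (λ x → A x × B x)
  a ∩ᵐ b = measurable-≐
    ((λ ¬ab → dne (λ ¬a → ¬ab (inj₁ ¬a)) , dne (λ ¬b → ¬ab (inj₂ ¬b))) ,
      λ (Ax , Bx) → [ (λ ¬a → ¬a Ax) , (λ ¬b → ¬b Bx) ]′)
    (∁-measurable (∁-measurable a ∪ᵐ ∁-measurable b))

  _⇒_ : Measurable A → Measurable B → Measurable (λ x → A x → B x)
  _⇒_ a b = measurable-≐
    ((λ { (inj₁ ¬a) Ax → ⊥-elim (¬a Ax) ; (inj₂ Bx) _ → Bx }) ,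
      λ f → [ inj₂ ∘ f , inj₁ ]′ (decide _))
    (∁-measurable a ∪ᵐ b)
    where
    decide : (P : Set) → P ⊎ ¬ P
    decide P with em {P = P}
    ... | yes p = inj₁ p
    ... | no ¬p = inj₂ ¬p

  _⇔ᵐ_ : Measurable A → Measurable B → Measurable (λ x → A x ⇔ B x)
  a ⇔ᵐ b = measurable-≐ ((λ (f , g) → mk⇔ f g) , λ e → to e , from e)
    ((a ⇒ b) ∩ᵐ (b ⇒ a))

-- Borel actions and the codes of points

module BorelAction (em : ∀ {ℓ} → ExcludedMiddle ℓ)
  (G : Group 0ℓ 0ℓ) (enumeration : Inverse (setoid ℕ) (Group.setoid G))
  (X : BorelSpaceOver G) where

  open Classical em
  open BorelSpaceOver X using (space; action; isBorelAction)
  open MeasurableSpace space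
  open Action action
  open MeasurableSets em space
  private module G = Group G

  e : ℕ → G.Carrier
  e = Inverse.to enumeration

  enumerated : ∀ g → ∃[ t ] e t G.≈ g
  enumerated g = Inverse.from enumeration g , Inverse.strictlyInverseˡ enumeration g

  ·-cong : ∀ {g h x y} → g G.≈ h → x ≈ y → g · x ≈ h · y
  ·-cong g≈h x≈y = Func.cong act (g≈h , x≈y)

  ·-congˡ : ∀ {g x y} → x ≈ y → g · x ≈ g · y
  ·-congˡ = ·-cong G.refl

  ·-congʳ : ∀ {g h x} → g G.≈ h → g · x ≈ h · x
  ·-congʳ g≈h = ·-cong g≈h refl

  g⁻¹·g·x : ∀ g x → g G.⁻¹ · g · x ≈ x
  g⁻¹·g·x g x = trans (sym (compose _ g x)) (trans (·-congʳ (G.inverseˡ g)) (identity x))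

  g·g⁻¹·x : ∀ g x → g · g G.⁻¹ · x ≈ x
  g·g⁻¹·x g x = trans (sym (compose g _ x)) (trans (·-congʳ (G.inverseʳ g)) (identity x))

  infix 4 _~_
  _~_ : Carrier → Carrier → Set
  _~_ = Orbit

  ~-sym : ∀ {x y} → x ~ y → y ~ x
  ~-sym (g , gx≈y) = g G.⁻¹ , trans (·-congˡ (sym gx≈y)) (g⁻¹·g·x g _)

  ~-trans : ∀ {x y z} → x ~ y → y ~ z → x ~ z
  ~-trans (g , gx≈y) (h , hy≈z) = h G.∙ g , trans (compose h g _) (trans (·-congˡ gx≈y) hy≈z)

  ~-act : ∀ {x y} g → x ~ y → x ~ g · y
  ~-act g x~y = ~-trans x~y (g , refl)

  reach : ∀ {x y} → x ~ y → ∃[ t ] e t · x ≈ y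
  reach (g , gx≈y) = let t , et≈g = enumerated g in t , trans (·-congʳ et≈g) gx≈y

  -- The translate is the section at `g` of the preimage of `A` under the action map. Sections are
  -- measurable by induction on the generation of the product σ-algebra; a rectangle has section `B`
  -- or nothing.
  translate : ∀ {A} g → Measurable A → Measurable (λ x → A (g · x))
  translate g a = section (isBorelAction _ a)
    where
    section : ∀ {C} →
      MeasurableSpace.Measurable (productSpace (discreteSpace G.setoid) space) C →
      Measurable (λ x → C (g , x))
    section (generator (A , B , _ , b , C⊆ , ⊆C)) = measurable-≐ (⊆C , C⊆) (constant (A g) ∩ᵐ b)
    section (resp-≐ (A⊆B , B⊆A) a)                = measurable-≐ (A⊆B , B⊆A) (section a)
    section empty                                 = ∅-measurable
    section (complement a)                        = ∁-measurable (section a)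
    section (union A as)                          = ⋃-measurable _ (section ∘ as)

  -- y and z have the same image under x ↦ (g ↦ [g⁻¹x ∈ A]).
  Same : Pred Carrier 0ℓ → Carrier → Carrier → Set
  Same A y z = ∀ t → A (e t · y) ⇔ A (e t · z)

  -- Finiteness on the orbit of `x` is phrased as a bound on the indices of representatives, so that
  -- only countable quantifiers occur and the condition is Borel.
  FiniteImage : Pred Carrier 0ℓ → Pred Carrier 0ℓ
  FiniteImage A x = ∃[ N ] (∀ t → ∃[ n ] n < N × Same A (e t · x) (e n · x))

  FiniteImage-measurable : ∀ {A} → Measurable A → Measurable (FiniteImage A)
  FiniteImage-measurable a = any λ N → all λ t → any λ n → constant (n < N) ∩ᵐ
    all λ s → translate (e t) (translate (e s) a) ⇔ᵐ translate (e n) (translate (e s) a)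

  module _ {A : Pred Carrier 0ℓ} (a : Measurable A) where

    ≈⇒⇔ : ∀ {x y} → x ≈ y → A x ⇔ A y
    ≈⇒⇔ x≈y = mk⇔ (measurable-≈ a x≈y) (measurable-≈ a (sym x≈y))

    ≈⇒Same : ∀ {x y} → x ≈ y → Same A x y
    ≈⇒Same x≈y t = ≈⇒⇔ (·-congˡ x≈y)

    Same-· : ∀ {y z} → Same A y z → ∀ g → A (g · y) ⇔ A (g · z)
    Same-· same g =
      let t , et≈g = enumerated g
      in ⇔.trans (≈⇒⇔ (·-congʳ (G.sym et≈g))) (⇔.trans (same t) (≈⇒⇔ (·-congʳ et≈g)))

    Same-act : ∀ {y z} g → Same A y z → Same A (g · y) (g · z)
    Same-act g same t = ⇔.trans (≈⇒⇔ (sym (compose (e t) g _)))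
      (⇔.trans (Same-· same (e t G.∙ g)) (≈⇒⇔ (compose (e t) g _)))

    Same⇒⇔ : ∀ {y z} → Same A y z → A y ⇔ A z
    Same⇒⇔ same = ⇔.trans (≈⇒⇔ (sym (identity _))) (⇔.trans (Same-· same G.ε) (≈⇒⇔ (identity _)))

  Same-sym : ∀ A {y z} → Same A y z → Same A z y
  Same-sym A same t = ⇔.sym (same t)

  Same-trans : ∀ A {x y z} → Same A x y → Same A y z → Same A x z
  Same-trans A s s′ t = ⇔.trans (s t) (s′ t)

  -- The lexicographic order on codes

  -- Codes are read along the enumeration `e`, and at the first disagreement it is `z` that must lie
  -- in `C`. Beyond that place the premise of agreement fails, so nothing more is demanded.
  Lex : Pred Carrier 0ℓ → Carrier → Carrier → Set
  Lex C y z = ∀ t → (∀ s → s < t → C (e s · y) ⇔ C (e s · z)) → C (e t · y) → C (e t · z)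

  module _ (C : Pred Carrier 0ℓ) where

    Same⇒Lex : ∀ {y z} → Same C y z → Lex C y z
    Same⇒Lex same t _ = to (same t)

    Lex-trans : ∀ {x y z} → Lex C x y → Lex C y z → Lex C x z
    Lex-trans {x} {y} {z} xy yz t agree =
      yz t (λ s s<t → proj₂ (both t ℕ.≤-refl s s<t)) ∘ xy t (λ s s<t → proj₁ (both t ℕ.≤-refl s s<t))
      where
      -- Where `x` and `z` agree, `y` agrees with both: at each place the implications from `x` to
      -- `y` to `z` close to a cycle.
      both : ∀ u → u ≤ t → ∀ s → s < u →
             (C (e s · x) ⇔ C (e s · y)) × (C (e s · y) ⇔ C (e s · z))
      both (suc u) u<t s (ℕ.s≤s s≤u) = mk⇔ xy′ (from (agree s s<t) ∘ yz′) , mk⇔ yz′ (xy′ ∘ from (agree s s<t))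
        where
        s<t = ℕ.≤-<-trans s≤u u<t
        below = λ r r<s → both u (ℕ.<⇒≤ u<t) r (ℕ.<-≤-trans r<s s≤u)
        xy′ = xy s (λ r r<s → proj₁ (below r r<s))
        yz′ = yz s (λ r r<s → proj₂ (below r r<s))

    Lex-antisym : ∀ {y z} → Lex C y z → Lex C z y → Same C y z
    Lex-antisym {y} {z} yz zy t = agree (suc t) t ℕ.≤-refl
      where
      agree : ∀ u s → s < u → C (e s · y) ⇔ C (e s · z)
      agree (suc u) s (ℕ.s≤s s≤u) = mk⇔ (yz s below) (zy s (λ r r<s → ⇔.sym (below r r<s)))
        where below = λ r r<s → agree u r (ℕ.<-≤-trans r<s s≤u)

    -- A failure of `Lex C y z` yields the first disagreement `t`, with `y` on the larger side
    -- there; this decides the reverse comparison.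
    Lex-total : ∀ y z → Lex C y z ⊎ Lex C z y
    Lex-total y z with em {P = Lex C y z}
    ... | yes y≼z = inj₁ y≼z
    ... | no y⋠z with ¬∀⇒∃¬ y⋠z
    ... | t , ¬step with ¬→⇒×¬ ¬step
    ... | agree , ¬step′ with ¬→⇒×¬ ¬step′
    ... | Cy , ¬Cz = inj₂ z≼y
      where
      z≼y : Lex C z y
      z≼y s agree′ Cz with ℕ.<-cmp s t
      ... | tri< s<t _ _    = from (agree s s<t) Cz
      ... | tri≈ _ ≡.refl _ = Cy
      ... | tri> _ _ t<s    = ⊥-elim (¬Cz (from (agree′ t t<s) Cy))

  -- The decreasing blocks and the layers between them

  module Chain (C : ℕ → Pred Carrier 0ℓ) (C-measurable : ∀ n → Measurable (C n)) where

    P : ℕ → Pred Carrier 0ℓ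
    P zero    y = ⊤
    P (suc n) y = P n y × (∀ t → P n (e t · y) → Lex (C n) (e t · y) y)

    Drop : ℕ → Pred Carrier 0ℓ
    Drop n x = ∃[ t ] P n (e t · x) × ¬ P (suc n) (e t · x)

    -- Says that the number of `k < n` with `Drop k x` is even. For a stage `n` that is itself a
    -- drop, this is the parity of its rank.
    Even : ℕ → Pred Carrier 0ℓ
    Even zero    x = ⊤
    Even (suc n) x = Drop n x × ¬ Even n x ⊎ ¬ Drop n x × Even n x

    EvenLayers : Pred Carrier 0ℓ
    EvenLayers x = ∃[ n ] (P n x × ¬ P (suc n) x) × Even n x

    P-measurable : ∀ n → Measurable (P n)
    P-measurable zero    = constant ⊤
    P-measurable (suc n) = P-measurable n ∩ᵐ all λ t → translate (e t) (P-measurable n) ⇒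
      all λ s → (all λ r → constant (r < s) ⇒ translate (e t) (code r) ⇔ᵐ code r) ⇒
        translate (e t) (code s) ⇒ code s
      where code = λ s → translate (e s) (C-measurable n)

    Drop-measurable : ∀ n → Measurable (Drop n)
    Drop-measurable n = any λ t →
      translate (e t) (P-measurable n) ∩ᵐ ∁-measurable (translate (e t) (P-measurable (suc n)))

    Even-measurable : ∀ n → Measurable (Even n)
    Even-measurable zero    = constant ⊤
    Even-measurable (suc n) =
      Drop-measurable n ∩ᵐ ∁-measurable (Even-measurable n) ∪ᵐ
      ∁-measurable (Drop-measurable n) ∩ᵐ Even-measurable n

    EvenLayers-measurable : Measurable EvenLayers
    EvenLayers-measurable = any λ n →
      (P-measurable n ∩ᵐ ∁-measurable (P-measurable (suc n))) ∩ᵐ Even-measurable n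

    P-resp : ∀ n → P n Respects _≈_
    P-resp n = measurable-≈ (P-measurable n)

    P-antitone : ∀ {m n} → m ≤ n → P n ⊆ P m
    P-antitone m≤n = down (ℕ.≤⇒≤′ m≤n)
      where
      down : ∀ {m n} → m ℕ.≤′ n → P n ⊆ P m
      down ℕ.≤′-refl       p       = p
      down (ℕ.≤′-step m≤n) (p , _) = down m≤n p

    P-maximal : ∀ n {y z} → y ~ z → P (suc n) y → P n z → Lex (C n) z y
    P-maximal n y~z (_ , max) Pz with reach y~z
    ... | t , ty≈z = Lex-trans (C n) (Same⇒Lex (C n) (≈⇒Same (C-measurable n) (sym ty≈z)))
                               (max t (P-resp n (sym ty≈z) Pz))

    -- Both points are greatest in the same block, so each dominates the other.
    P-same : ∀ n {y z} → y ~ z → P (suc n) y → P (suc n) z → Same (C n) y z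
    P-same n y~z Py Pz =
      Lex-antisym (C n) (P-maximal n (~-sym y~z) Pz (proj₁ Py)) (P-maximal n y~z Py (proj₁ Pz))

    -- The block property: points of one block have equal codes under `C n`, hence so do their
    -- images under `g`; if one image is greatest, so is the other.
    P-block : ∀ n g {y z} → y ~ z → P n y → P n (g · y) → P n z → P n (g · z)
    P-block zero    g y~z _  _   _  = tt
    P-block (suc n) g {y} {z} y~z Py Pgy Pz =
      P-block n g y~z (proj₁ Py) (proj₁ Pgy) (proj₁ Pz) , λ t Ptgz →
        Lex-trans (C n) (P-maximal n (~-act (e t) (~-act g (~-trans (~-sym (g , refl)) y~z))) Pgy Ptgz)
          (Same⇒Lex (C n) (Same-act (C-measurable n) g (P-same n y~z Py Pz)))

    Drop-invariant : ∀ n {x y} → x ~ y → Drop n x → Drop n y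
    Drop-invariant n x~y (t , p , ¬p) with reach (~-act (e t) (~-sym x~y))
    ... | s , sy≈tx = s , P-resp n (sym sy≈tx) p , ¬p ∘ P-resp (suc n) sy≈tx

    Even-invariant : ∀ n {x y} → x ~ y → Even n x → Even n y
    Even-invariant zero    x~y _ = tt
    Even-invariant (suc n) x~y (inj₁ (d , ¬ev)) =
      inj₁ (Drop-invariant n x~y d , ¬ev ∘ Even-invariant n (~-sym x~y))
    Even-invariant (suc n) x~y (inj₂ (¬d , ev)) =
      inj₂ (¬d ∘ Drop-invariant n (~-sym x~y) , Even-invariant n x~y ev)

    -- The sets `P n` decrease, so a point is lost at only one stage.
    EvenLayers⇔Even : ∀ n {x} → P n x → ¬ P (suc n) x → EvenLayers x ⇔ Even n x
    EvenLayers⇔Even n {x} Pn ¬Pn = mk⇔ unique λ ev → n , (Pn , ¬Pn) , ev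
      where
      unique : EvenLayers x → Even n x
      unique (m , (Pm , ¬Pm) , ev) with ℕ.<-cmp m n
      ... | tri< m<n _ _    = ⊥-elim (¬Pm (P-antitone m<n Pn))
      ... | tri≈ _ ≡.refl _ = ev
      ... | tri> _ _ n<m    = ⊥-elim (¬Pn (P-antitone n<m Pm))

-- An infinite orbit on which all the codes have finite image is impossible

module NotAllFinite (em : ∀ {ℓ} → ExcludedMiddle ℓ)
  (G : Group 0ℓ 0ℓ) (enumeration : Inverse (setoid ℕ) (Group.setoid G))
  (X : BorelSpaceOver G)
  (C : ℕ → Pred (MeasurableSpace.Carrier (BorelSpaceOver.space X)) 0ℓ)
  (C-measurable : ∀ n → MeasurableSpace.Measurable (BorelSpaceOver.space X) (C n))
  (C-separates : SeparatesPoints (BorelSpaceOver.space X) C)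
  where

  open Classical em
  open BorelSpaceOver X using (space; action)
  open MeasurableSpace space
  open Action action
  open BorelAction em G enumeration X
  open Chain C C-measurable
  private module G = Group G

  module _ (x : Carrier) (infinite : AperiodicPart x)
    (finiteC : ∀ n → FiniteImage (C n) x) (finiteP : ∀ n → FiniteImage (P n) x)
    (finiteA : FiniteImage EvenLayers x) where

    -- An infinite set of codes could lack a greatest element; finiteness of the image under `C n`
    -- supplies one.
    P-nonempty : ∀ n → ∃[ y ] x ~ y × P n y
    P-nonempty zero    = x , (G.ε , identity x) , tt
    P-nonempty (suc n) =
      let N , represented = finiteC n
          m , (x~m , Pm) , max = greatest (Lex (C n)) (Lex-trans (C n)) (Lex-total (C n))
            (λ i → e i · x) N (λ y → x ~ y × P n y) (cover represented) (P-nonempty n)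
      in m , x~m , Pm , λ t Ptm → max (~-act (e t) x~m , Ptm)
      where
      cover : ∀ {N} → (∀ t → ∃[ i ] i < N × Same (C n) (e t · x) (e i · x)) →
        ∀ {y} → x ~ y × P n y →
        ∃[ i ] i < N × Lex (C n) y (e i · x) × Lex (C n) (e i · x) y
      cover represented (x~y , _) with reach x~y
      ... | t , tx≈y with represented t
      ... | i , i<N , same = i , i<N , Same⇒Lex (C n) same′ , Same⇒Lex (C n) (Same-sym (C n) same′)
        where same′ = Same-trans (C n) (≈⇒Same (C-measurable n) (sym tx≈y)) same

    NoDropsIn : ℕ → ℕ → Set
    NoDropsIn m n = ∀ {k} → m ≤ k → k < n → ¬ Drop k x

    P-persists : ∀ {m n} → m ≤ n → NoDropsIn m n → ∀ {y} → x ~ y → P m y → P n y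
    P-persists m≤n = up (ℕ.≤⇒≤′ m≤n)
      where
      up : ∀ {m n} → m ℕ.≤′ n → NoDropsIn m n → ∀ {y} → x ~ y → P m y → P n y
      up ℕ.≤′-refl _ _ Pmy = Pmy
      up {n = suc n} (ℕ.≤′-step m≤n) ¬drop {y} x~y Pmy with reach x~y
      ... | t , tx≈y = dne λ ¬P → ¬drop (ℕ.≤′⇒≤ m≤n) ℕ.≤-refl
        (t , P-resp n (sym tx≈y) (up m≤n (λ m≤k k<n → ¬drop m≤k (ℕ.m<n⇒m<1+n k<n)) x~y Pmy)
           , ¬P ∘ P-resp (suc n) tx≈y)

    Even-persists : ∀ {m n} → m ≤ n → NoDropsIn m n → Even n x ⇔ Even m x
    Even-persists m≤n = up (ℕ.≤⇒≤′ m≤n)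
      where
      up : ∀ {m n} → m ℕ.≤′ n → NoDropsIn m n → Even n x ⇔ Even m x
      up ℕ.≤′-refl _ = ⇔.refl
      up {n = suc n} (ℕ.≤′-step m≤n) ¬drop = ⇔.trans
        (mk⇔ [ ⊥-elim ∘ ¬drop (ℕ.≤′⇒≤ m≤n) ℕ.≤-refl ∘ proj₁ , proj₂ ]′
             (λ ev → inj₂ (¬drop (ℕ.≤′⇒≤ m≤n) ℕ.≤-refl , ev)))
        (up m≤n λ m≤k k<n → ¬drop m≤k (ℕ.m<n⇒m<1+n k<n))

    Even-flips : ∀ {n} → Drop n x → Even (suc n) x ⇔ (¬ Even n x)
    Even-flips d = mk⇔ [ proj₂ , ⊥-elim ∘ (λ ¬d → ¬d d) ∘ proj₁ ]′ λ ¬ev → inj₁ (d , ¬ev)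

    -- If `P n` met the orbit only in `p`, two orbit points with the same code under `P n` would be
    -- sent to `p` by a common `g` and hence coincide; finitely many codes would then make the orbit
    -- finite.
    P-not-singleton : ∀ n → ¬ (∀ {y z} → x ~ y → P n y → P n z → y ~ z → y ≈ z)
    P-not-singleton n single =
      let N , represented = finiteP n
          p , x~p , Pp = P-nonempty n
          member : ∀ y → x ~ y → ∃[ i ] i < N × y ≈ e i · x
          member y x~y =
            let t , tx≈y = reach x~y
                i , i<N , same = represented t
                g , gtx≈p = ~-trans (~-sym (e t , refl)) x~p
                Pgtx = P-resp n (sym gtx≈p) Pp
                gtx≈gix = single (~-act g (e t , refl)) Pgtx (to (Same-· (P-measurable n) same g) Pgtx)
                  (~-trans (~-sym (~-act g (e t , refl))) (~-act g (e i , refl)))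
            in i , i<N , trans (sym tx≈y)
                 (trans (sym (g⁻¹·g·x g _)) (trans (·-congˡ gtx≈gix) (g⁻¹·g·x g _)))
      in infinite (applyUpTo (λ i → e i · x) N , λ y x~y →
           let i , i<N , y≈ix = member y x~y
           in ∈-resp-≈ points (sym y≈ix) (∈-applyUpTo⁺ points (λ i → e i · x) i<N))

    -- Without further drops the points of the block would stay together forever, agree on every
    -- `C k`, and be equal by separation.
    drop-after : ∀ n → ∃[ m ] n ≤ m × Drop m x
    drop-after n = dne λ ¬drop → P-not-singleton n λ {y} {z} x~y Py Pz y~z →
      -- The block survives to stage `n + k` and hence lies in `P k`, whether `k` is below or above
      -- `n`.
      let persists = λ k {w} → P-persists (ℕ.m≤m+n n k) (λ n≤j _ d → ¬drop (_ , n≤j , d)) {w}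
          inP = λ k {w} x~w Pw → P-antitone (ℕ.m≤n+m k n) (persists k {w} x~w Pw)
      in C-separates λ k → Same⇒⇔ (C-measurable k)
           (P-same k y~z (inP (suc k) x~y Py) (inP (suc k) (~-trans x~y y~z) Pz))

    next-drop : ∀ n → ∃[ m ] (n ≤ m × Drop m x) × NoDropsIn n m
    next-drop n =
      let k , k-drop = drop-after n
          m , drop , min = least (λ m → n ≤ m × Drop m x) k k-drop
      in m , drop , λ n≤j j<m d → min j<m (n≤j , d)

    b : ℕ → ℕ
    b zero    = proj₁ (next-drop 0)
    b (suc i) = proj₁ (next-drop (suc (b i)))

    b-drop : ∀ i → Drop (b i) x
    b-drop zero    = proj₂ (proj₁ (proj₂ (next-drop 0)))
    b-drop (suc i) = proj₂ (proj₁ (proj₂ (next-drop (suc (b i)))))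

    b-step : ∀ i → b i < b (suc i)
    b-step i = proj₁ (proj₁ (proj₂ (next-drop (suc (b i)))))

    b-mono : ∀ {i j} → i ≤ j → b i ≤ b j
    b-mono i≤j = up (ℕ.≤⇒≤′ i≤j)
      where
      up : ∀ {i j} → i ℕ.≤′ j → b i ≤ b j
      up ℕ.≤′-refl           = ℕ.≤-refl
      up (ℕ.≤′-step {j} i≤j) = ℕ.≤-trans (up i≤j) (ℕ.<⇒≤ (b-step j))

    -- From `b i` up to but excluding `b (suc i)` the only drop is the one at `b i`.
    b-parity : ∀ i → Even (b (suc i)) x ⇔ (¬ Even (b i) x)
    b-parity i = ⇔.trans (Even-persists (b-step i) (proj₂ (proj₂ (next-drop (suc (b i))))))
                         (Even-flips (b-drop i))

    -- Moves `x` to a point lost at stage `b i`.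
    a : ℕ → G.Carrier
    a i = e (proj₁ (b-drop i))

    a-in : ∀ i → P (b i) (a i · x)
    a-in i = proj₁ (proj₂ (b-drop i))

    a-out : ∀ i → ¬ P (suc (b i)) (a i · x)
    a-out i = proj₂ (proj₂ (b-drop i))

    -- Every orbit point has the `EvenLayers` code of some `e k · x` with `k < M`. Recording where
    -- `a i` sends these representatives gives a self-map of `Fin M`, which decides for every `y` in
    -- the orbit whether `a i · y` lies in `EvenLayers`.
    similar : ∃₂ λ i j → i < j × (∀ {y} → x ~ y → EvenLayers (a i · y) ⇔ EvenLayers (a j · y))
    similar =
      let M , represented = finiteA
          representative : ∀ g → ∃[ k ] Same EvenLayers (g · x) (e (toℕ {M} k) · x)
          representative g =
            let t , et≈g = enumerated g
                k , k<M , same = represented t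
            in fromℕ< k<M , Same-trans EvenLayers (≈⇒Same EvenLayers-measurable (·-congʳ (G.sym et≈g)))
                 (≡.subst (λ k → Same EvenLayers (e t · x) (e k · x)) (≡.sym (toℕ-fromℕ< k<M)) same)
          acts : ℕ → Fin M → Fin M
          acts i k = proj₁ (representative (a i G.∙ e (toℕ k)))
          acts⇒ : ∀ i k → EvenLayers (a i · e (toℕ k) · x) ⇔ EvenLayers (e (toℕ (acts i k)) · x)
          acts⇒ i k = ⇔.trans (≈⇒⇔ EvenLayers-measurable (sym (compose _ _ x)))
            (Same⇒⇔ EvenLayers-measurable (proj₂ (representative (a i G.∙ e (toℕ k)))))
          -- There are `M ^ M` self-maps, so among one more index than that two share their map.
          i , j , i<j , fi≡fj = pigeonhole (ℕ.n<1+n (M ℕ.^ M)) (funToFin ∘ acts ∘ toℕ)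
          acts≡ : ∀ k → acts (toℕ i) k ≡ acts (toℕ j) k
          acts≡ k = ≡.trans (≡.sym (finToFun-funToFin (acts (toℕ i)) k))
            (≡.trans (≡.cong (λ f → finToFun f k) fi≡fj) (finToFun-funToFin (acts (toℕ j)) k))
      in toℕ i , toℕ j , i<j , λ (g , gx≈y) →
        let k , same = representative g
            reduce = λ l → ⇔.trans (≈⇒⇔ EvenLayers-measurable (·-congˡ (sym gx≈y)))
              (⇔.trans (Same-· EvenLayers-measurable same (a l)) (acts⇒ l k))
        in ⇔.trans (reduce (toℕ i)) (⇔.trans
             (≡.subst (λ l → EvenLayers (e (toℕ (acts (toℕ i) k)) · x) ⇔ EvenLayers (e (toℕ l) · x))
               (acts≡ k) ⇔.refl)
             (⇔.sym (reduce (toℕ j))))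

    not-all-finite : ⊥
    not-all-finite =
      let i , j , i<j , a-similar = similar
          g = a j G.∙ a i G.⁻¹
          w = a (suc i) · x
          z = a i · x
          x~w = a (suc i) , refl
          x~z = a i , refl
          z~w = ~-trans (~-sym x~z) x~w
          g·a : ∀ y → g · y ≈ a j · a i G.⁻¹ · y
          g·a y = compose (a j) (a i G.⁻¹) y
          gz≈ : g · z ≈ a j · x
          gz≈ = trans (g·a z) (·-congˡ (g⁻¹·g·x (a i) x))
          -- Apply `a-similar` at `a i ⁻¹ · w`: `a i` takes it back to `w`, and `a j` takes it to
          -- `g · w`.
          w⇔gw : EvenLayers w ⇔ EvenLayers (g · w)
          w⇔gw = ⇔.trans (≈⇒⇔ EvenLayers-measurable (sym (g·g⁻¹·x (a i) w)))
            (⇔.trans (a-similar (~-act (a i G.⁻¹) x~w)) (≈⇒⇔ EvenLayers-measurable (sym (g·a w))))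
          Pw : P (suc (b i)) w
          Pw = P-antitone (b-step i) (a-in (suc i))
          -- By `i < j`, the point `a j · x` is lost only at `b j`, which is beyond `b i`.
          Pgz : P (suc (b i)) (g · z)
          Pgz = P-resp (suc (b i)) (sym gz≈)
            (P-antitone (ℕ.≤-trans (b-step i) (b-mono i<j)) (a-in j))
          Pgw : P (b i) (g · w)
          Pgw = P-block (b i) g z~w (a-in i) (proj₁ Pgz) (proj₁ Pw)
          -- Otherwise `g ⁻¹` would map `g · w` to `w` within the block, and therefore also `g · z`
          -- to `z`, which was lost at stage `b i`.
          ¬Pgw : ¬ P (suc (b i)) (g · w)
          ¬Pgw Pgw′ = a-out i (P-resp (suc (b i)) (g⁻¹·g·x g z)
            (P-block (suc (b i)) (g G.⁻¹)
              (~-trans (~-sym (~-act g x~w)) (~-act g x~z))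
              Pgw′ (P-resp (suc (b i)) (sym (g⁻¹·g·x g w)) Pw) Pgz))
          invariant = λ n {y} (x~y : x ~ y) → mk⇔ (Even-invariant n (~-sym x~y)) (Even-invariant n x~y)
          -- `w` is lost at stage `b (suc i)` and `g · w` at stage `b i`; as both or neither lie in
          -- `EvenLayers`, the parities would be equal, against `b-parity`.
          flips : Even (b (suc i)) x ⇔ Even (b i) x
          flips = ⇔.trans (⇔.sym (invariant (b (suc i)) x~w)) (⇔.trans
            (⇔.sym (EvenLayers⇔Even (b (suc i)) (a-in (suc i)) (a-out (suc i)))) (⇔.trans w⇔gw (⇔.trans
            (EvenLayers⇔Even (b i) Pgw ¬Pgw) (invariant (b i) (~-act g x~w)))))
          odd : ¬ Even (b i) x
          odd ev = to (b-parity i) (from flips ev) ev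
      in odd (to flips (from (b-parity i) odd))

-- The equivariant Borel map to the shift given by a Borel set

module Coding (em : ∀ {ℓ} → ExcludedMiddle ℓ)
  (G : Group 0ℓ 0ℓ) (enumeration : Inverse (setoid ℕ) (Group.setoid G))
  (X : BorelSpaceOver G) where

  open Classical em
  open BorelSpaceOver X using (space; action)
  open MeasurableSpace space
  open Action action
  open MeasurableSets em space
  open BorelAction em G enumeration X
  private
    module G = Group G
    module 2^G = Setoid (2^ G)
  open GroupProperties G using (⁻¹-anti-homo-\\; ⁻¹-involutive)

  truth : Set → Bool
  truth A = does (em {P = A})

  truth-cong : ∀ {A B} → A ⇔ B → truth A ≡ truth B
  truth-cong A⇔B = does-⇔ A⇔B em em

  truth-true : ∀ {A} → truth A ≡ true → A
  truth-true {A} eq with em {P = A}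
  ... | yes a = a
  truth-true () | no _

  truth⇒⇔ : ∀ {A B} → truth A ≡ truth B → A ⇔ B
  truth⇒⇔ eq = mk⇔ (λ a → truth-true (≡.trans (≡.sym eq) (dec-true em a)))
                   (λ b → truth-true (≡.trans eq (dec-true em b)))

  module _ {A : Pred Carrier 0ℓ} (a : Measurable A) where

    code : Func points (2^ G)
    code = record
      { to   = λ x → record
        { to   = λ h → truth (A (h G.⁻¹ · x))
        ; cong = λ h≈k → truth-cong (≈⇒⇔ a (·-congʳ (G.⁻¹-cong h≈k)))
        }
      ; cong = λ x≈y h → truth-cong (≈⇒⇔ a (·-congˡ x≈y))
      }

    -- The shift by `g` evaluates at `g⁻¹h`, whose inverse is `h⁻¹g`.
    code-equivariant : IsEquivariant action (shift G) code
    code-equivariant g x h = truth-cong (≈⇒⇔ a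
      (trans (sym (compose (h G.⁻¹) g x)) (·-congʳ (G.sym (⁻¹-anti-homo-\\ g h)))))

    code≈⇒Same : ∀ {y z} → (code ⟨$⟩ y) 2^G.≈ (code ⟨$⟩ z) → Same A y z
    code≈⇒Same eq t = ⇔.trans (≈⇒⇔ a (·-congʳ (G.sym (⁻¹-involutive (e t)))))
      (⇔.trans (truth⇒⇔ (eq (e t G.⁻¹))) (≈⇒⇔ a (·-congʳ (⁻¹-involutive (e t)))))

    -- By equivariance the codes of all `e t · y` occur in the list. For each entry that is such a
    -- code one index is kept, and `N` exceeds all the kept indices.
    finite-orbit⇒FiniteImage : ∀ {x y} → x ~ y →
      IsFinite (2^ G) (Action.Orbit (shift G) (code ⟨$⟩ x)) → FiniteImage A y
    finite-orbit⇒FiniteImage {x} {y} (h , hx≈y) (ys , covers) =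
      let N , found = bound ys
      in N , λ t → found t (covers (code ⟨$⟩ (e t · y)) (e t G.∙ h , inOrbit t))
      where
      open Membership (2^ G) using (_∈_)
      inOrbit : ∀ t → Action._·_ (shift G) (e t G.∙ h) (code ⟨$⟩ x) 2^G.≈ (code ⟨$⟩ (e t · y))
      inOrbit t k = ≡.trans (≡.sym (code-equivariant (e t G.∙ h) x k))
        (Func.cong code (trans (compose (e t) h x) (·-congˡ hx≈y)) k)
      bound : ∀ ys → ∃[ N ] (∀ t → (code ⟨$⟩ (e t · y)) ∈ ys →
                             ∃[ n ] n < N × Same A (e t · y) (e n · y))
      bound [] = 0 , λ t ()
      bound (z ∷ ys) with bound ys | em {P = ∃[ n ] (code ⟨$⟩ (e n · y)) 2^G.≈ z}
      ... | N , found | no ¬z = N , λ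
        { t (here eq)    → ⊥-elim (¬z (t , eq))
        ; t (there t∈ys) → found t t∈ys }
      ... | N , found | yes (n , n≈z) = suc n ℕ.⊔ N , λ
        { t (here eq)    → n , ℕ.m≤m⊔n (suc n) N , code≈⇒Same (λ k → ≡.trans (eq k) (≡.sym (n≈z k)))
        ; t (there t∈ys) → let m , m<N , same = found t t∈ys
                           in m , ℕ.<-≤-trans m<N (ℕ.m≤n⊔m (suc n) N) , same }

    code-measurable : IsMeasurableMap space (borelSpace (productTopology G)) code
    -- A cylinder inside an open `W` can be taken over an initial segment of the enumeration. The
    -- preimage is thus the union over `n` of the points whose first `n` code values already force
    -- membership in `W`.
    code-measurable _ (generator {W} W-open) = measurable-≐
      ((λ (n , v) → v (code ⟨$⟩ _) tt λ _ _ → ≡.refl) , λ {x} Wx →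
        let F , cylinder = W-open (code ⟨$⟩ x) Wx
            n , within = prefix x F
        in n , λ y _ agree → cylinder (within y agree))
      (any λ n → decided n (λ _ → ⊤))
      where
      Agree : ℕ → Carrier → 2^G.Carrier → Set
      Agree n x y = ∀ t → t < n → y ⟨$⟩ e t ≡ code ⟨$⟩ x ⟨$⟩ e t

      prefix : ∀ x F → ∃[ n ] (∀ y → Agree n x y → All (λ h → y ⟨$⟩ h ≡ code ⟨$⟩ x ⟨$⟩ h) F)
      prefix x []      = 0 , λ _ _ → []
      prefix x (h ∷ F) =
        let n , within = prefix x F
            t , et≈h   = enumerated h
        in suc t ℕ.⊔ n , λ y agree →
             ≡.trans (Func.cong y (G.sym et≈h))
               (≡.trans (agree t (ℕ.m≤m⊔n (suc t) n)) (Func.cong (code ⟨$⟩ x) et≈h))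
             ∷ within y λ s s<n → agree s (ℕ.<-≤-trans s<n (ℕ.m≤n⊔m (suc t) n))

      value-measurable : ∀ t v → Measurable (λ x → code ⟨$⟩ x ⟨$⟩ e t ≡ v)
      value-measurable t true  = measurable-≐ (dec-true em , truth-true) (translate (e t G.⁻¹) a)
      value-measurable t false = measurable-≐
        (dec-false em , λ eq Ax → case ≡.trans (≡.sym eq) (dec-true em Ax) of λ ())
        (∁-measurable (translate (e t G.⁻¹) a))

      -- The condition depends on `x` only through `n` bits. Each recursive step splits on the last
      -- bit and moves it into the constraint `K`; at `zero` no dependence on `x` remains.
      decided : ∀ n (K : Pred 2^G.Carrier 0ℓ) → Measurable (λ x → ∀ y → K y → Agree n x y → W y)
      decided zero    K = measurable-≐
        ((λ all y k _ → all y k) , λ all y k → all y k λ _ ())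
        (constant (∀ y → K y → W y))
      decided (suc n) K = measurable-≐
        ((λ { (inj₁ (eq , all)) → extend eq all ; (inj₂ (eq , all)) → extend eq all }) , λ {x} → restrict x)
        (branch true ∪ᵐ branch false)
        where
        K′ : Bool → Pred 2^G.Carrier 0ℓ
        K′ v y = K y × y ⟨$⟩ e n ≡ v
        branch = λ v → value-measurable n v ∩ᵐ decided n (K′ v)
        extend : ∀ {v x} → code ⟨$⟩ x ⟨$⟩ e n ≡ v → (∀ y → K′ v y → Agree n x y → W y) →
                 ∀ y → K y → Agree (suc n) x y → W y
        extend eq all y k agree = all y (k , ≡.trans (agree n ℕ.≤-refl) eq)
          λ t t<n → agree t (ℕ.m<n⇒m<1+n t<n)
        shrink : ∀ {v x} → code ⟨$⟩ x ⟨$⟩ e n ≡ v → (∀ y → K y → Agree (suc n) x y → W y) →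
                 ∀ y → K′ v y → Agree n x y → W y
        shrink {x = x} eq all y (k , yn) agree = all y k λ t t<1+n → case ℕ.m≤n⇒m<n∨m≡n (ℕ.≤-pred t<1+n) of λ
          { (inj₁ t<n)    → agree t t<n
          ; (inj₂ ≡.refl) → ≡.trans yn (≡.sym eq) }
        restrict : ∀ x → (∀ y → K y → Agree (suc n) x y → W y) →
          (code ⟨$⟩ x ⟨$⟩ e n ≡ true × (∀ y → K′ true y → Agree n x y → W y)) ⊎
          (code ⟨$⟩ x ⟨$⟩ e n ≡ false × (∀ y → K′ false y → Agree n x y → W y))
        restrict x all with truth (A (e n G.⁻¹ · x)) in eq
        ... | true  = inj₁ (≡.refl , shrink eq all)
        ... | false = inj₂ (≡.refl , shrink eq all)
    code-measurable _ (resp-≐ (B⊆C , C⊆B) b) = measurable-≐ (B⊆C , C⊆B) (code-measurable _ b)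
    code-measurable _ empty                  = ∅-measurable
    code-measurable _ (complement b)         = ∁-measurable (code-measurable _ b)
    code-measurable _ (union B bs)           = ⋃-measurable _ (λ n → code-measurable _ (bs n))

  -- Choosing, orbit by orbit, the first set that works

  module Selection (E : ℕ → Pred Carrier 0ℓ) (E-measurable : ∀ n → Measurable (E n)) where

    -- Quantifying over the translates `e t · x` builds invariance under the action into the
    -- condition.
    Good : ℕ → Pred Carrier 0ℓ
    Good n x = ∃[ t ] ¬ FiniteImage (E n) (e t · x)

    FirstGood : ℕ → Pred Carrier 0ℓ
    FirstGood n x = Good n x × (∀ m → m < n → ¬ Good m x)

    Selected : Pred Carrier 0ℓ
    Selected x = ∃[ n ] FirstGood n x × E n x

    Good-measurable : ∀ n → Measurable (Good n)
    Good-measurable n = any λ t → translate (e t) (∁-measurable (FiniteImage-measurable (E-measurable n)))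

    Selected-measurable : Measurable Selected
    Selected-measurable = any λ n →
      (Good-measurable n ∩ᵐ all λ m → constant (m < n) ⇒ ∁-measurable (Good-measurable m)) ∩ᵐ
      E-measurable n

    Good-invariant : ∀ n {x y} → x ~ y → Good n x → Good n y
    Good-invariant n x~y (t , infinite) =
      let s , sy≈tx = reach (~-act (e t) (~-sym x~y))
      in s , infinite ∘ measurable-≈ (FiniteImage-measurable (E-measurable n)) sy≈tx

    FirstGood-invariant : ∀ n {x y} → x ~ y → FirstGood n x → FirstGood n y
    FirstGood-invariant n x~y (good , first) =
      Good-invariant n x~y good , λ m m<n → first m m<n ∘ Good-invariant m (~-sym x~y)

    -- The first good index is unique, so no other `E m` contributes at `x`.
    Selected⇔ : ∀ {n x} → FirstGood n x → Selected x ⇔ E n x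
    Selected⇔ {n} {x} (good , first) = mk⇔ unique λ En → n , (good , first) , En
      where
      unique : Selected x → E n x
      unique (m , (good′ , first′) , Em) with ℕ.<-cmp m n
      ... | tri< m<n _ _    = ⊥-elim (first m m<n good′)
      ... | tri≈ _ ≡.refl _ = Em
      ... | tri> _ _ n<m    = ⊥-elim (first′ n n<m good)

    -- On the orbit of `x` the selected set agrees with `E n` for the first good `n`, so a finite
    -- orbit of the code would give `E n` a finite image there.
    Selected-aperiodic : (∀ x → ∃[ n ] Good n x) →
      ∀ x → Action.AperiodicPart (shift G) (code Selected-measurable ⟨$⟩ x)
    Selected-aperiodic exists x finite =
      let k , k-good = exists x
          n , (t , infinite) , below = least (λ n → Good n x) k k-good
          first = (t , infinite) , λ m m<n → below m<n
          N , represented = finite-orbit⇒FiniteImage Selected-measurable (e t , refl) finite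
          selected = λ {y} (x~y : x ~ y) → Selected⇔ (FirstGood-invariant n x~y first)
          onOrbit = λ s r → ~-act (e s) (~-act (e r) (e t , refl))
      in infinite (N , λ s →
           let i , i<N , same = represented s
           in i , i<N , λ r → ⇔.trans (⇔.sym (selected (onOrbit r s)))
                (⇔.trans (same r) (selected (onOrbit r i))))

theorem8p8 : (∀ {ℓ} → ExcludedMiddle ℓ) →
    (G : Group 0ℓ 0ℓ) → Inverse (setoid ℕ) (Group.setoid G) →
    (X : BorelSpaceOver G) → BorelSpaceOver.IsAperiodic X →
    Σ[ f ∈ Func (BorelSpaceOver.points X) (2^ G) ]
    IsMeasurableMap (BorelSpaceOver.space X) (borelSpace (productTopology G)) f
    × IsEquivariant (BorelSpaceOver.action X) (shift G) f
    × (∀ x → Action.AperiodicPart (shift G) (f ⟨$⟩ x))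
theorem8p8 em G enumeration X aperiodic =
    code Selected-measurable
  , code-measurable Selected-measurable
  , code-equivariant Selected-measurable
  , Selected-aperiodic someGood
  where
  open BorelSpaceOver X using (space; isStandardBorel; action)
  open Action action using (_·_)
  open MeasurableSpace space using (Carrier; Measurable)
  open Classical em
  open BorelAction em G enumeration X
  open Coding em G enumeration X

  C : ℕ → Pred Carrier 0ℓ
  C = rationalBall space isStandardBorel ∘ ℕ×ℚ-enumeration

  C-measurable : ∀ n → Measurable (C n)
  C-measurable = rationalBall-measurable space isStandardBorel ∘ ℕ×ℚ-enumeration

  open Chain C C-measurable

  -- The three kinds of sets share one index set; `EvenLayers` is repeated to fill all remaining
  -- indices.
  candidate : ℕ × ℕ → Pred Carrier 0ℓ
  candidate (0 , n)           = C n
  candidate (1 , n)           = P n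
  candidate (suc (suc _) , _) = EvenLayers

  candidate-measurable : ∀ p → Measurable (candidate p)
  candidate-measurable (0 , n)           = C-measurable n
  candidate-measurable (1 , n)           = P-measurable n
  candidate-measurable (suc (suc _) , _) = EvenLayers-measurable

  open Selection (candidate ∘ unpair) (candidate-measurable ∘ unpair)

  someGood : ∀ x → ∃[ n ] Good n x
  someGood x = dne λ ¬good →
    -- Failure of `Good` gives finite images at the translates `e t · x`; the contradiction is drawn
    -- at `t = 0`, on the same orbit.
    let finite = λ k n → let i , eq = unpair-surjective k n in
          ≡.subst (λ p → FiniteImage (candidate p) (e 0 · x)) eq (dne λ infinite → ¬good (i , 0 , infinite))
    in NotAllFinite.not-all-finite em G enumeration X C C-measurable
         (rationalBall-separates space isStandardBorel)
         (e 0 · x) (aperiodic (e 0 · x)) (finite 0) (finite 1) (finite 2 0)
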